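{- Let $f$ and $g$ be as defined in the context. Then $f(n,a)=f(n+1,a)$ holds for every $a,n\in\mathbb{N}^+$ with $n\ge\lceil\log_2 a\rceil+1$ if and only if $g(n',m)=g(n'+1,m)$ holds for every $m,n'\in\mathbb{N}^+$ with $m\ge2$ and $n'\ge\lceil\log_2 m\rceil$.
   Context: A family $\mathcal{F}$ on ground set $[n]=\{1,\dots,n\}$ is a collection $\mathcal{S}(\mathcal{F})$ of distinct subsets of $[n]$ (elements of $[n]$ may lie in no set); $m(\mathcal{F})=|\mathcal{S}(\mathcal{F})|$. It is union-closed if $S\cup T\in\mathcal{S}(\mathcal{F})$ whenever $S,T\in\mathcal{S}(\mathcal{F})$. For $e\in[n]$, $m_e(\mathcal{F})$ is the number of sets of $\mathcal{F}$ containing $e$, and $a(\mathcal{F})=\max_{e\in[n]}m_e(\mathcal{F})$. For $n,a\in\mathbb{N}^+$, $f(n,a)$ is the maximum of $m(\mathcal{F})$ over all union-closed families $\mathcal{F}$ on ground set $[n]$ with $\mathcal{S}(\mathcal{F})\neq\emptyset$ and $a(\mathcal{F})\le a$. For $n,m\in\mathbb{N}^+$ with $m\ge2$ and $m\le 2^n$, $g(n,m)$ is the minimum of $a(\mathcal{F})$ over all union-closed families $\mathcal{F}$ on ground set $[n]$ with $m(\mathcal{F})=m$. -}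

module Defs where

open import Data.Nat using (ℕ; suc; _≤_; _≥_; _<_)
open import Data.Fin using (Fin)
open import Data.Fin.Subset using (Subset; _∪_) renaming (_∈_ to _∈ₛ_)
open import Data.Fin.Subset.Properties using (_∈?_)
open import Data.List using (List; []; length; filter)
open import Data.List.Membership.Propositional using (_∈_)
open import Data.List.Relation.Unary.Unique.Propositional using (Unique)
open import Data.Product using (Σ; _×_; ∃)
open import Relation.Binary.PropositionalEquality using (_≡_; _≢_)

record Family (n : ℕ) : Set where
  constructor family
  field
    sets     : List (Subset n)
    distinct : Unique sets
open Family public

m : ∀ {n} → Family n → ℕ
m F = length (sets F)

mₑ : ∀ {n} → Family n → Fin n → ℕ
mₑ F e = length (filter (e ∈?_) (sets F))

UnionClosed : ∀ {n} → Family n → Set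
UnionClosed F = ∀ {S T} → S ∈ sets F → T ∈ sets F → (S ∪ T) ∈ sets F

-- a(F) ≤ a  (a(F) is the max over e ∈ [n] of m_e(F))
aBound : ∀ {n} → Family n → ℕ → Set
aBound F a = ∀ e → mₑ F e ≤ a

aIs : ∀ {n} → Family n → ℕ → Set
aIs {n} F k = aBound F k × (∀ k' → aBound F k' → k ≤ k')

IsF : ℕ → ℕ → ℕ → Set
IsF n a k =
  (Σ (Family n) λ F → UnionClosed F × sets F ≢ [] × aBound F a × m F ≡ k)
  × (∀ (F : Family n) → UnionClosed F → sets F ≢ [] → aBound F a → m F ≤ k)

IsG : ℕ → ℕ → ℕ → Set
IsG n mm k =
  (Σ (Family n) λ F → UnionClosed F × m F ≡ mm × aIs F k)
  × (∀ (F : Family n) → UnionClosed F → m F ≡ mm → ∀ a → aIs F a → k ≤ a)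

{-# OPTIONS --safe #-}

-- Call (n, M, a) realizable if some union-closed family of M subsets of [n] has all degrees ≤ a.
-- Deleting a set of minimum size keeps a family union-closed, so realizability is monotone in M and
-- a, f(n,a) is the largest M and g(n,M) the smallest a, and f and g determine each other. Beyond the
-- trivial bound given by the power set, the one difficulty is to deduce from stability of g that no
-- family of q + 1 sets, q = 2ⁿ, on [n+1] has all degrees ≤ q/2. Its j-th power has (q+1)ʲ sets and
-- degrees ≤ (q/2)(q+1)ʲ⁻¹. At the first j with (q+1)ʲ ≥ 2qʲ, shrink it to 2qʲ = 2ⁿʲ⁺¹ sets; by
-- stability of g the ground set may be taken to be [nj+1], so that the family is the whole power set,
-- yet its degrees are less than qʲ.
-- The extremal values are only shown to exist up to double negation, which suffices because
-- equality of natural numbers is stable.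

module Submission where

open import Defs hiding (m)
open import Data.Fin using (zero; splitAt)
open import Data.Fin.Subset using (Subset; _∪_; _⊆_; inside; outside; ∣_∣; Empty)
open import Data.Fin.Subset.Properties using (_∈?_; p⊆p∪q; p⊆q⇒∣p∣≤∣q∣; drop-∷-⊆; Empty-unique)
open import Data.List using (List; []; _∷_; map; length; filter; cartesianProductWith)
open import Data.List.Membership.Propositional using (_∈_)
open import Data.List.Membership.Propositional.Properties using (∈-cartesianProductWith⁺; ∈-cartesianProductWith⁻; ∈-filter⁺)
open import Data.List.Properties using (length-++; length-map; filter-++; filter-accept; filter-reject)
open import Data.List.Relation.Binary.Permutation.Propositional using (_↭_; ↭⇒↭ₛ; ↭-refl; ↭-sym; ↭-trans; prep; swap)
open import Data.List.Relation.Binary.Permutation.Propositional.Properties using (∈-resp-↭; ↭-length; filter-↭)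
open import Data.List.Relation.Binary.Permutation.Setoid.Properties using (Unique-resp-↭)
open import Data.List.Relation.Unary.All as All using (All; []; _∷_)
open import Data.List.Relation.Unary.AllPairs using ([]; _∷_)
open import Data.List.Relation.Unary.Any using (here; there)
open import Data.List.Relation.Unary.Unique.Propositional using (Unique)
open import Data.List.Relation.Unary.Unique.Propositional.Properties using (cartesianProductWith⁺)
open import Data.Nat using (ℕ; zero; suc; _+_; _*_; _∸_; _^_; _≤_; _<_; _≥_; z≤n; s≤s; s≤s⁻¹; _≤?_; ⌈_/2⌉; ⌊_/2⌋)
open import Data.Nat.Induction using (<-rec; <-wellFounded)
open import Data.Nat.Logarithm using (⌈log₂_⌉; ⌈log₂⌉-mono-≤; ⌈log₂2^n⌉≡n)
open import Data.Nat.Logarithm.Core using (⌈log2⌉)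
open import Data.Nat.Properties
open import Data.Nat.Tactic.RingSolver using (solve-∀)
open import Data.Product using (Σ; ∃; _×_; _,_; proj₁; proj₂)
open import Data.Sum using (inj₁; inj₂; [_,_]′)
open import Data.Vec using ([]; _∷_; here; there; lookup) renaming (_++_ to _⧺_)
open import Data.Vec.Properties using (zipWith-++; ++-injective; lookup-splitAt; []=⇒lookup; lookup⇒[]=)
open import Function using (_∘_)
open import Function.Bundles using (_⇔_; mk⇔)
open import Induction.WellFounded using (Acc; acc)
open import Level using (Level)
open import Relation.Binary.PropositionalEquality using (_≡_; _≢_; refl; sym; trans; cong; cong₂; subst; setoid)
open import Relation.Nullary using (¬_; yes; no; contradiction)
open import Relation.Nullary.Decidable using (decidable-stable)
open import Relation.Unary using (Pred; Decidable)

private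
  variable
    ℓ ℓ′ : Level
    A B C : Set ℓ
    n N M a : ℕ

-- Arithmetic and extremal elements

-- The logarithm is defined by well-founded recursion. Quantifying over the accessibility proof lets
-- the induction hypothesis apply to whichever proof the recursive call carries.
n≤2^⌈log2⌉n : ∀ n (rs : Acc _<_ n) → n ≤ 2 ^ ⌈log2⌉ n rs
n≤2^⌈log2⌉n 0             _        = z≤n
n≤2^⌈log2⌉n 1             _        = s≤s z≤n
n≤2^⌈log2⌉n (suc (suc n)) (acc rs) = begin
  2 + n                   ≡⟨ cong (2 +_) (⌊n/2⌋+⌈n/2⌉≡n n) ⟨
  2 + (⌊ n /2⌋ + ⌈ n /2⌉) ≤⟨ +-monoʳ-≤ 2 (+-monoˡ-≤ ⌈ n /2⌉ (⌊n/2⌋≤⌈n/2⌉ n)) ⟩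
  2 + (⌈ n /2⌉ + ⌈ n /2⌉) ≡⟨ lemma ⌈ n /2⌉ ⟩
  2 * suc ⌈ n /2⌉         ≤⟨ *-monoʳ-≤ 2 (n≤2^⌈log2⌉n (suc ⌈ n /2⌉) _) ⟩
  2 ^ ⌈log2⌉ (2 + n) (acc rs) ∎
  where
  open ≤-Reasoning
  lemma : ∀ x → 2 + (x + x) ≡ 2 * suc x
  lemma = solve-∀

⌈log₂n⌉≤k⇒n≤2^k : ∀ n {k} → ⌈log₂ n ⌉ ≤ k → n ≤ 2 ^ k
⌈log₂n⌉≤k⇒n≤2^k n p = ≤-trans (n≤2^⌈log2⌉n n (<-wellFounded n)) (^-monoʳ-≤ 2 p)

n≤2^k⇒⌈log₂n⌉≤k : ∀ {n} k → n ≤ 2 ^ k → ⌈log₂ n ⌉ ≤ k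
n≤2^k⇒⌈log₂n⌉≤k k p = ≤-trans (⌈log₂⌉-mono-≤ p) (≤-reflexive (⌈log₂2^n⌉≡n k))

-- Bernoulli's inequality 1 + j/q ≤ (1 + 1/q)ʲ, cleared of denominators.
bernoulli : ∀ q j → (q + j) * q ^ j ≤ q * suc q ^ j
bernoulli q zero    = ≤-reflexive (cong (_* 1) (+-identityʳ q))
bernoulli q (suc j) = begin
  (q + suc j) * (q * q ^ j)             ≤⟨ m≤m+n _ (j * q ^ j) ⟩
  (q + suc j) * (q * q ^ j) + j * q ^ j ≡⟨ lemma q j (q ^ j) ⟩
  suc q * ((q + j) * q ^ j)             ≤⟨ *-monoʳ-≤ (suc q) (bernoulli q j) ⟩
  suc q * (q * suc q ^ j)               ≡⟨ lemma′ q (suc q ^ j) ⟩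
  q * (suc q * suc q ^ j)               ∎
  where
  open ≤-Reasoning
  lemma : ∀ q j x → (q + suc j) * (q * x) + j * x ≡ suc q * ((q + j) * x)
  lemma = solve-∀
  lemma′ : ∀ q x → suc q * (q * x) ≡ q * (suc q * x)
  lemma′ = solve-∀

2*q^q≤[1+q]^q : ∀ q → 1 ≤ q → 2 * q ^ q ≤ suc q ^ q
2*q^q≤[1+q]^q q@(suc _) _ = *-cancelˡ-≤ q (≤-trans (≤-reflexive (lemma q (q ^ q))) (bernoulli q q))
  where
  lemma : ∀ q x → q * (2 * x) ≡ (q + q) * x
  lemma = solve-∀

-- `Q` need not be decidable, so no search is possible; but if no least element exists, strong
-- induction refutes `Q` at every number.
¬¬-least : (Q : ℕ → Set ℓ) → ∀ {b} → Q b → ¬ ¬ (∃ λ k → Q k × (∀ j → Q j → k ≤ j))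
¬¬-least Q {b} Qb ¬least = none b Qb
  where
  none : ∀ k → ¬ Q k
  none = <-rec (λ k → ¬ Q k) λ k rec Qk →
    ¬least (k , Qk , λ j Qj → ≮⇒≥ λ j<k → rec j<k Qj)

-- A greatest element below `B` is one whose distance from `B` is least.
¬¬-greatest : (Q : ℕ → Set ℓ) → ∀ B → (∀ j → Q j → j ≤ B) → ∀ {b} → Q b →
              ¬ ¬ (∃ λ k → Q k × (∀ j → Q j → j ≤ k))
¬¬-greatest Q B bound {b} Qb ¬greatest =
  ¬¬-least Deficit (b , Qb , m+[n∸m]≡n (bound b Qb)) λ where
    (d , (k , Qk , k+d≡B) , minimal) → ¬greatest (k , Qk , λ j Qj →
      +-cancelʳ-≤ d j k (begin
        j + d       ≤⟨ +-monoʳ-≤ j (minimal (B ∸ j) (j , Qj , m+[n∸m]≡n (bound j Qj))) ⟩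
        j + (B ∸ j) ≡⟨ m+[n∸m]≡n (bound j Qj) ⟩
        B           ≡⟨ k+d≡B ⟨
        k + d       ∎))
  where
  open ≤-Reasoning
  Deficit : ℕ → Set _
  Deficit d = ∃ λ k → Q k × k + d ≡ B

-- Realizable parameters

Realizable : ℕ → ℕ → ℕ → Set
Realizable n M a = Σ (Family n) λ F → UnionClosed F × length (sets F) ≡ M × aBound F a

weaken : ∀ {a b} → a ≤ b → Realizable n M a → Realizable n M b
weaken a≤b (F , uc , eq , bd) = F , uc , eq , λ e → ≤-trans (bd e) a≤b

-- Products of families

length-cartesianProductWith : (f : A → B → C) → ∀ xs ys →
  length (cartesianProductWith f xs ys) ≡ length xs * length ys
length-cartesianProductWith f []       ys = refl
length-cartesianProductWith f (x ∷ xs) ys =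
  trans (length-++ (map (f x) ys)) (cong₂ _+_ (length-map (f x) ys) (length-cartesianProductWith f xs ys))

module _ {P : Pred C ℓ} (P? : Decidable P) (f : A → B → C) where

  -- With `f` concatenation, `P` membership of `e` and `Q` membership of the matching element of the
  -- first ground set, this computes degrees in a product of families.
  length-filter-cartesianProductWithˡ :
    {Q : Pred A ℓ′} (Q? : Decidable Q) → (∀ x y → P (f x y) → Q x) → (∀ x y → Q x → P (f x y)) →
    ∀ xs ys → length (filter P? (cartesianProductWith f xs ys)) ≡ length (filter Q? xs) * length ys
  length-filter-cartesianProductWithˡ Q? to from []       ys = refl
  length-filter-cartesianProductWithˡ Q? to from (x ∷ xs) ys
    rewrite filter-++ P? (map (f x) ys) (cartesianProductWith f xs ys)
          | length-++ (filter P? (map (f x) ys)) {filter P? (cartesianProductWith f xs ys)}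
          | length-filter-cartesianProductWithˡ Q? to from xs ys
    with Q? x
  ... | yes Qx = cong (_+ _) (all ys)
    where
    all : ∀ ys → length (filter P? (map (f x) ys)) ≡ length ys
    all []       = refl
    all (y ∷ ys) rewrite filter-accept P? {xs = map (f x) ys} (from x y Qx) = cong suc (all ys)
  ... | no ¬Qx = cong (_+ _) (none ys)
    where
    none : ∀ ys → length (filter P? (map (f x) ys)) ≡ 0
    none []       = refl
    none (y ∷ ys) rewrite filter-reject P? {xs = map (f x) ys} (¬Qx ∘ to x y) = none ys

  length-filter-cartesianProductWithʳ :
    {Q : Pred B ℓ′} (Q? : Decidable Q) → (∀ x y → P (f x y) → Q y) → (∀ x y → Q y → P (f x y)) →
    ∀ xs ys → length (filter P? (cartesianProductWith f xs ys)) ≡ length xs * length (filter Q? ys)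
  length-filter-cartesianProductWithʳ Q? to from []       ys = refl
  length-filter-cartesianProductWithʳ Q? to from (x ∷ xs) ys
    rewrite filter-++ P? (map (f x) ys) (cartesianProductWith f xs ys)
          | length-++ (filter P? (map (f x) ys)) {filter P? (cartesianProductWith f xs ys)}
          | length-filter-cartesianProductWithʳ Q? to from xs ys
    = cong (_+ _) (same ys)
    where
    same : ∀ ys → length (filter P? (map (f x) ys)) ≡ length (filter Q? ys)
    same []       = refl
    same (y ∷ ys) with Q? y
    ... | yes Qy rewrite filter-accept P? {xs = map (f x) ys} (from x y Qy)    = cong suc (same ys)
    ... | no ¬Qy rewrite filter-reject P? {xs = map (f x) ys} (¬Qy ∘ to x y) = same ys

-- The sets are the concatenations of a set of each family. An element of the first ground set has
-- its old degree times `M₂`, one of the second `M₁` times its old degree; two separate inequalities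
-- replace a maximum.
product : ∀ {N₁ N₂ M₁ M₂ a₁ a₂ a} → a₁ * M₂ ≤ a → M₁ * a₂ ≤ a →
          Realizable N₁ M₁ a₁ → Realizable N₂ M₂ a₂ → Realizable (N₁ + N₂) (M₁ * M₂) a
product {N₁} {N₂} {a = a} a₁M₂≤a M₁a₂≤a (F , ucF , refl , bdF) (G , ucG , refl , bdG) =
  family FG (cartesianProductWith⁺ _⧺_ (λ {w} {x} → ++-injective w x) (distinct F) (distinct G)) ,
  uc , length-cartesianProductWith _⧺_ (sets F) (sets G) , bd
  where
  FG = cartesianProductWith _⧺_ (sets F) (sets G)

  uc : ∀ {S T} → S ∈ FG → T ∈ FG → (S ∪ T) ∈ FG
  uc S∈ T∈
    with ∈-cartesianProductWith⁻ _⧺_ (sets F) (sets G) S∈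
       | ∈-cartesianProductWith⁻ _⧺_ (sets F) (sets G) T∈
  ... | S₁ , S₂ , S₁∈ , S₂∈ , refl | T₁ , T₂ , T₁∈ , T₂∈ , refl =
    subst (_∈ FG) (sym (zipWith-++ _ S₁ S₂ T₁ T₂)) (∈-cartesianProductWith⁺ _⧺_ (ucF S₁∈ T₁∈) (ucG S₂∈ T₂∈))

  bd : ∀ e → length (filter (e ∈?_) FG) ≤ a
  bd e with splitAt N₁ e in eq
  ... | inj₁ i = begin
    length (filter (e ∈?_) FG)
      ≡⟨ length-filter-cartesianProductWithˡ (e ∈?_) _⧺_ (i ∈?_)
           (λ S T e∈ → lookup⇒[]= i S (trans (sym (at S T)) ([]=⇒lookup e∈)))
           (λ S T i∈ → lookup⇒[]= e (S ⧺ T) (trans (at S T) ([]=⇒lookup i∈))) (sets F) (sets G) ⟩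
    mₑ F i * length (sets G) ≤⟨ *-monoˡ-≤ (length (sets G)) (bdF i) ⟩
    _                        ≤⟨ a₁M₂≤a ⟩
    a                        ∎
    where
    open ≤-Reasoning
    at : ∀ S T → lookup (S ⧺ T) e ≡ lookup S i
    at S T = trans (lookup-splitAt N₁ S T e) (cong [ lookup S , lookup T ]′ eq)
  ... | inj₂ i = begin
    length (filter (e ∈?_) FG)
      ≡⟨ length-filter-cartesianProductWithʳ (e ∈?_) _⧺_ (i ∈?_)
           (λ S T e∈ → lookup⇒[]= i T (trans (sym (at S T)) ([]=⇒lookup e∈)))
           (λ S T i∈ → lookup⇒[]= e (S ⧺ T) (trans (at S T) ([]=⇒lookup i∈))) (sets F) (sets G) ⟩
    length (sets F) * mₑ G i ≤⟨ *-monoʳ-≤ (length (sets F)) (bdG i) ⟩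
    _                        ≤⟨ M₁a₂≤a ⟩
    a                        ∎
    where
    open ≤-Reasoning
    at : ∀ S T → lookup (S ⧺ T) e ≡ lookup T i
    at S T = trans (lookup-splitAt N₁ S T e) (cong [ lookup S , lookup T ]′ eq)

realizable-0-1-0 : Realizable 0 1 0
realizable-0-1-0 = family ([] ∷ []) ([] ∷ []) , (λ { {[]} {[]} _ _ → here refl }) , refl , λ ()

realizable-1-1-0 : Realizable 1 1 0
realizable-1-1-0 = family ((outside ∷ []) ∷ []) ([] ∷ []) ,
  (λ { (here refl) (here refl) → here refl }) , refl , λ { zero → z≤n }

realizable-1-2-1 : Realizable 1 2 1
realizable-1-2-1 = family ((outside ∷ []) ∷ (inside ∷ []) ∷ []) (((λ ()) ∷ []) ∷ [] ∷ []) ,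
  (λ { {outside ∷ []} {outside ∷ []} _ _ → here refl
     ; {outside ∷ []} {inside ∷ []} _ _ → there (here refl)
     ; {inside ∷ []} {_ ∷ []} _ _ → there (here refl) }) ,
  refl , λ { zero → s≤s z≤n }

-- The product with the family {∅} on one point adds an element that lies in no set.
extend : Realizable n M a → Realizable (suc n) M a
extend {n} {M} {a} r =
  subst (λ M → Realizable (suc n) M a) (+-identityʳ M)
    (product z≤n (≤-reflexive (+-identityʳ a)) realizable-1-1-0 r)

realizable-n-1-0 : ∀ n → Realizable n 1 0
realizable-n-1-0 zero    = realizable-0-1-0
realizable-n-1-0 (suc n) = extend (realizable-n-1-0 n)

power : Realizable N M a → ∀ j → Realizable (suc j * N) (M ^ suc j) (a * M ^ j)
power {N} {M} {a} r zero    = product ≤-refl (≤-trans (≤-reflexive (*-zeroʳ M)) z≤n) r realizable-0-1-0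
power {N} {M} {a} r (suc j) = product ≤-refl (≤-reflexive (lemma M a (M ^ j))) r (power r j)
  where
  lemma : ∀ M a x → M * (a * x) ≡ a * (M * x)
  lemma = solve-∀

powerset : ∀ p → Realizable (suc p) (2 ^ suc p) (2 ^ p)
powerset p =
  subst (λ N → Realizable N (2 ^ suc p) (2 ^ p)) (*-identityʳ (suc p))
    (weaken (≤-reflexive (*-identityˡ (2 ^ p))) (power realizable-1-2-1 p))

-- Removing sets

p⊆q∧∣q∣≤∣p∣⇒p≡q : {p q : Subset n} → p ⊆ q → ∣ q ∣ ≤ ∣ p ∣ → p ≡ q
p⊆q∧∣q∣≤∣p∣⇒p≡q {p = []}          {[]}          p⊆q le = refl
p⊆q∧∣q∣≤∣p∣⇒p≡q {p = outside ∷ p} {outside ∷ q} p⊆q le = cong (outside ∷_) (p⊆q∧∣q∣≤∣p∣⇒p≡q (drop-∷-⊆ p⊆q) le)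
p⊆q∧∣q∣≤∣p∣⇒p≡q {p = outside ∷ p} {inside ∷ q}  p⊆q le = contradiction (p⊆q⇒∣p∣≤∣q∣ (drop-∷-⊆ p⊆q)) (<⇒≱ le)
p⊆q∧∣q∣≤∣p∣⇒p≡q {p = inside ∷ p}  {outside ∷ q} p⊆q le = contradiction (p⊆q here) λ ()
p⊆q∧∣q∣≤∣p∣⇒p≡q {p = inside ∷ p}  {inside ∷ q}  p⊆q le = cong (inside ∷_) (p⊆q∧∣q∣≤∣p∣⇒p≡q (drop-∷-⊆ p⊆q) (s≤s⁻¹ le))

extract-minimum : (h : A → ℕ) → ∀ x xs → ∃ λ y → ∃ λ ys → (x ∷ xs ↭ y ∷ ys) × All (λ z → h y ≤ h z) ys
extract-minimum h x []        = x , [] , ↭-refl , []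
extract-minimum h x (x′ ∷ xs) with extract-minimum h x′ xs
... | y , ys , perm , min with ≤-total (h x) (h y)
...   | inj₁ hx≤hy = x , y ∷ ys , prep x perm , hx≤hy ∷ All.map (≤-trans hx≤hy) min
...   | inj₂ hy≤hx = y , x ∷ ys , ↭-trans (prep x perm) (swap x y ↭-refl) , hy≤hx ∷ min

-- A set of minimum cardinality is not the union of two other sets.
removeOne : Realizable n (suc M) a → Realizable n M a
removeOne (family [] _ , _ , () , _)
removeOne {n} {M} {a} (family (x ∷ xs) xs! , uc , eq , bd)
  with y , ys , perm , min ← extract-minimum ∣_∣ x xs
  with y∉ys ∷ ys! ← Unique-resp-↭ (setoid (Subset n)) (↭⇒↭ₛ perm) xs! =
  family ys ys! , uc′ , suc-injective (trans (sym (↭-length perm)) eq) , bd′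
  where
  uc′ : ∀ {S T} → S ∈ ys → T ∈ ys → (S ∪ T) ∈ ys
  uc′ {S} {T} S∈ T∈
    with ∈-resp-↭ perm (uc (∈-resp-↭ (↭-sym perm) (there S∈)) (∈-resp-↭ (↭-sym perm) (there T∈)))
  ... | there S∪T∈ = S∪T∈
  ... | here S∪T≡y = contradiction (sym S≡y) (All.lookup y∉ys S∈)
    where
    S≡y : S ≡ y
    S≡y = p⊆q∧∣q∣≤∣p∣⇒p≡q (subst (S ⊆_) S∪T≡y (p⊆p∪q T)) (All.lookup min S∈)

  bd′ : ∀ e → length (filter (e ∈?_) ys) ≤ a
  bd′ e = ≤-trans grow (≤-trans (≤-reflexive (sym (↭-length (filter-↭ (e ∈?_) perm)))) (bd e))
    where
    grow : length (filter (e ∈?_) ys) ≤ length (filter (e ∈?_) (y ∷ ys))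
    grow with e ∈? y
    ... | yes _ = n≤1+n _
    ... | no  _ = ≤-refl

shrink : ∀ {M M′} → M′ ≤ M → Realizable n M a → Realizable n M′ a
shrink {n} {a} {M} {M′} M′≤M r =
  go (M ∸ M′) (subst (λ M → Realizable n M a) (sym (m∸n+n≡m M′≤M)) r)
  where
  go : ∀ d → Realizable n (d + M′) a → Realizable n M′ a
  go zero    r = r
  go (suc d) r = go d (removeOne r)

realizable-2^ : ∀ p → M ≤ 2 ^ suc p → Realizable (suc p) M (2 ^ p)
realizable-2^ p M≤ = shrink M≤ (powerset p)

-- Bounds on realizable parameters

-- Splitting a family at the element `zero` into `link` and `deletion` drives the counting:
-- distinctness survives in each half, and the size of the link is the degree of `zero`.
link : List (Subset (suc n)) → List (Subset n)
link []                   = []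
link ((inside  ∷ p) ∷ xs) = p ∷ link xs
link ((outside ∷ p) ∷ xs) = link xs

deletion : List (Subset (suc n)) → List (Subset n)
deletion []                   = []
deletion ((inside  ∷ p) ∷ xs) = deletion xs
deletion ((outside ∷ p) ∷ xs) = p ∷ deletion xs

length-link+deletion : (xs : List (Subset (suc n))) → length xs ≡ length (link xs) + length (deletion xs)
length-link+deletion []                   = refl
length-link+deletion ((inside  ∷ p) ∷ xs) = cong suc (length-link+deletion xs)
length-link+deletion ((outside ∷ p) ∷ xs) =
  trans (cong suc (length-link+deletion xs)) (sym (+-suc (length (link xs)) _))

length-link : (xs : List (Subset (suc n))) → length (link xs) ≡ length (filter (zero ∈?_) xs)
length-link []                   = refl
length-link ((inside  ∷ p) ∷ xs) = cong suc (length-link xs)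
length-link ((outside ∷ p) ∷ xs) = length-link xs

link-All : ∀ {p : Subset n} {xs} → All (inside ∷ p ≢_) xs → All (p ≢_) (link xs)
link-All {xs = []}                 []         = []
link-All {xs = (inside  ∷ q) ∷ xs} (ne ∷ nes) = (ne ∘ cong (inside ∷_)) ∷ link-All nes
link-All {xs = (outside ∷ q) ∷ xs} (ne ∷ nes) = link-All nes

deletion-All : ∀ {p : Subset n} {xs} → All (outside ∷ p ≢_) xs → All (p ≢_) (deletion xs)
deletion-All {xs = []}                 []         = []
deletion-All {xs = (inside  ∷ q) ∷ xs} (ne ∷ nes) = deletion-All nes
deletion-All {xs = (outside ∷ q) ∷ xs} (ne ∷ nes) = (ne ∘ cong (outside ∷_)) ∷ deletion-All nes

link-Unique : {xs : List (Subset (suc n))} → Unique xs → Unique (link xs)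
link-Unique {xs = []}                 []        = []
link-Unique {xs = (inside  ∷ p) ∷ xs} (ne ∷ xs!) = link-All ne ∷ link-Unique xs!
link-Unique {xs = (outside ∷ p) ∷ xs} (ne ∷ xs!) = link-Unique xs!

deletion-Unique : {xs : List (Subset (suc n))} → Unique xs → Unique (deletion xs)
deletion-Unique {xs = []}                 []        = []
deletion-Unique {xs = (inside  ∷ p) ∷ xs} (ne ∷ xs!) = deletion-Unique xs!
deletion-Unique {xs = (outside ∷ p) ∷ xs} (ne ∷ xs!) = deletion-All ne ∷ deletion-Unique xs!

Unique⇒length≤2^n : ∀ n {xs : List (Subset n)} → Unique xs → length xs ≤ 2 ^ n
Unique⇒length≤2^n zero    {[]}           _               = z≤n
Unique⇒length≤2^n zero    {_ ∷ []}       _               = s≤s z≤n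
Unique⇒length≤2^n zero    {[] ∷ [] ∷ xs} ((ne ∷ _) ∷ _) = contradiction refl ne
Unique⇒length≤2^n (suc n) {xs}           xs!             = begin
  length xs                               ≡⟨ length-link+deletion xs ⟩
  length (link xs) + length (deletion xs) ≤⟨ +-mono-≤ (Unique⇒length≤2^n n (link-Unique xs!)) (Unique⇒length≤2^n n (deletion-Unique xs!)) ⟩
  2 ^ n + 2 ^ n                           ≡⟨ cong (2 ^ n +_) (+-identityʳ (2 ^ n)) ⟨
  2 ^ suc n                               ∎
  where open ≤-Reasoning

realizable⇒M≤2^n : Realizable n M a → M ≤ 2 ^ n
realizable⇒M≤2^n {n} (F , _ , refl , _) = Unique⇒length≤2^n n (distinct F)

-- At most 2ᵖ distinct sets avoid `zero`, so at least 2ᵖ contain it.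
full⇒2^p≤a : ∀ p → Realizable (suc p) (2 ^ suc p) a → 2 ^ p ≤ a
full⇒2^p≤a {a} p (F , _ , eq , bd) = +-cancelʳ-≤ (2 ^ p) (2 ^ p) a (begin
  2 ^ p + 2 ^ p                                         ≡⟨ cong (2 ^ p +_) (+-identityʳ (2 ^ p)) ⟨
  2 ^ suc p                                             ≡⟨ eq ⟨
  length (sets F)                                       ≡⟨ length-link+deletion (sets F) ⟩
  length (link (sets F)) + length (deletion (sets F))   ≡⟨ cong (_+ length (deletion (sets F))) (length-link (sets F)) ⟩
  mₑ F zero + length (deletion (sets F))                ≤⟨ +-mono-≤ (bd zero) (Unique⇒length≤2^n p (deletion-Unique (distinct F))) ⟩
  a + 2 ^ p                                             ∎)
  where open ≤-Reasoning

-- If all degrees were 0, every set would be empty, and two distinct sets could not exist.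
2≤M⇒1≤a : 2 ≤ M → Realizable n M a → 1 ≤ a
2≤M⇒1≤a {a = suc a} _ _ = s≤s z≤n
2≤M⇒1≤a (s≤s ()) (family (S ∷ []) _ , _ , refl , _)
2≤M⇒1≤a {a = zero} _ (family (S ∷ T ∷ xs) ((S≢T ∷ _) ∷ _) , _ , _ , bd) =
  contradiction (trans (Empty-unique (empty (here refl))) (sym (Empty-unique (empty (there (here refl)))))) S≢T
  where
  empty : ∀ {U} → U ∈ S ∷ T ∷ xs → Empty U
  empty U∈ (e , e∈U) with filter (e ∈?_) (S ∷ T ∷ xs) | ∈-filter⁺ (e ∈?_) U∈ e∈U | bd e
  ... | _ ∷ _ | _ | ()

-- The extremal functions

IsF⇒realizable : ∀ {n a k} → IsF n a k → Realizable n k a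
IsF⇒realizable ((F , uc , _ , bd , eq) , _) = F , uc , eq , bd

IsF⇒upper : ∀ {n a k} → IsF n a k → ∀ {M} → Realizable n M a → M ≤ k
IsF⇒upper _             {zero}  _                  = z≤n
IsF⇒upper (_ , greatest) {suc M} (F , uc , eq , bd) =
  subst (_≤ _) eq (greatest F uc (λ F≡[] → contradiction (trans (sym (cong length F≡[])) eq) λ ()) bd)

¬¬-IsF : ∀ n a → ¬ ¬ ∃ (IsF n a)
¬¬-IsF n a ¬f =
  -- The condition 1 ≤ k reflects that f ranges over nonempty families only; the family {∅} is the
  -- starting witness.
  ¬¬-greatest (λ k → 1 ≤ k × Realizable n k a) (2 ^ n) (λ _ → realizable⇒M≤2^n ∘ proj₂)
    (s≤s z≤n , weaken z≤n (realizable-n-1-0 n)) λ where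
      (k , (1≤k , F , uc , eq , bd) , upper) → ¬f (k ,
        (F , uc , (λ F≡[] → contradiction (trans (sym eq) (cong length F≡[])) (>⇒≢ 1≤k)) , bd , eq) ,
        λ G ucG G≢[] bdG → upper _ (nonEmpty G≢[] , G , ucG , refl , bdG))
  where
  nonEmpty : {xs : List (Subset n)} → xs ≢ [] → 1 ≤ length xs
  nonEmpty {[]}    xs≢[] = contradiction refl xs≢[]
  nonEmpty {_ ∷ _} _     = s≤s z≤n

IsG⇒realizable : ∀ {n M k} → IsG n M k → Realizable n M k
IsG⇒realizable ((F , uc , eq , bd , _) , _) = F , uc , eq , bd

-- A family attaining the least realizable bound has that bound as its exact maximum degree.
¬¬-IsG : ∀ {n M b} → Realizable n M b → ¬ ¬ (∃ λ k → IsG n M k × (∀ {a} → Realizable n M a → k ≤ a))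
¬¬-IsG {n} {M} r ¬g = ¬¬-least (Realizable n M) r λ where
  (k , (F , uc , eq , bd) , lower) → ¬g (k ,
    ((F , uc , eq , bd , λ k′ bd′ → lower k′ (F , uc , eq , bd′)) ,
     λ G ucG eqG a aIsG → lower a (G , ucG , eqG , proj₁ aIsG)) ,
    λ {a} → lower a)

-- `IsG` compares `k` with exact maximum degrees only, whereas `a` is just an upper bound; the
-- comparison passes through a family whose maximum degree is the least bound.
IsG⇒lower : ∀ {n M k} → IsG n M k → ∀ {a} → Realizable n M a → k ≤ a
IsG⇒lower {k = k} (_ , least) {a} r = decidable-stable (k ≤? a) λ k≰a →
  ¬¬-IsG r λ where
    (j , ((F , uc , eq , isA) , _) , lower) → k≰a (≤-trans (least F uc eq j isA) (lower r))

-- Equivalence of the two stability statements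

FStable : Set
FStable = ∀ (n a : ℕ) → 1 ≤ n → 1 ≤ a → n ≥ ⌈log₂ a ⌉ + 1 →
  ∀ k k' → IsF n a k → IsF (suc n) a k' → k ≡ k'

GStable : Set
GStable = ∀ (n' mm : ℕ) → 1 ≤ n' → 2 ≤ mm → mm ≤ 2 ^ n' → n' ≥ ⌈log₂ mm ⌉ →
  ∀ k k' → IsG n' mm k → IsG (suc n') mm k' → k ≡ k'

-- Let k′ = g(n+1,M). If k′ > 2ᵖ, with n = p + 1, a subfamily of the power set already gives g(n,M)
-- ≤ k′. Otherwise f is stable at k′, so M ≤ f(n+1,k′) = f(n,k′), and shrinking an optimal family on
-- [n] gives g(n,M) ≤ k′.
FStable⇒GStable : FStable → GStable
FStable⇒GStable hyp n@(suc p) M 1≤n 2≤M M≤2^n _ k k′ g g′ =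
  ≤-antisym (decidable-stable (k ≤? k′) λ k≰k′ → k≰k′-absurd k≰k′ (k′ ≤? 2 ^ p))
            (IsG⇒lower g′ (extend (IsG⇒realizable g)))
  where
  r′ = IsG⇒realizable g′
  k≰k′-absurd : ¬ k ≤ k′ → ¬ _
  k≰k′-absurd k≰k′ (no k′≰)  = k≰k′ (IsG⇒lower g (weaken (<⇒≤ (≰⇒> k′≰)) (realizable-2^ p M≤2^n)))
  k≰k′-absurd k≰k′ (yes k′≤) =
    ¬¬-IsF n k′ λ (l , f) → ¬¬-IsF (suc n) k′ λ (l′ , f′) →
      let l≡l′ = hyp n k′ 1≤n (2≤M⇒1≤a 2≤M r′)
                   (≤-trans (≤-reflexive (+-comm _ 1)) (s≤s (n≤2^k⇒⌈log₂n⌉≤k p k′≤))) l l′ f f′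
          M≤l  = subst (M ≤_) (sym l≡l′) (IsF⇒upper f′ r′)
      in k≰k′ (IsG⇒lower g (shrink M≤l (IsF⇒realizable f)))

module _ (hyp : GStable) where

  -- Stability of g removes one element from the ground set, as long as the smaller power set still
  -- has room for `M` sets.
  contract : ∀ p → 2 ≤ M → M ≤ 2 ^ suc p → Realizable (suc (suc p)) M a → ¬ ¬ Realizable (suc p) M a
  contract {M} p 2≤M M≤ r ¬r =
    ¬¬-IsG (realizable-2^ p M≤) λ (k , g , _) → ¬¬-IsG r λ (k′ , g′ , lower′) →
      let k≡k′ = hyp (suc p) M (s≤s z≤n) 2≤M M≤ (n≤2^k⇒⌈log₂n⌉≤k (suc p) M≤) k k′ g g′
      in ¬r (weaken (≤-trans (≤-reflexive k≡k′) (lower′ r)) (IsG⇒realizable g))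

  contract* : ∀ p d → 2 ≤ M → M ≤ 2 ^ suc p → Realizable (d + suc p) M a → ¬ ¬ Realizable (suc p) M a
  contract* p zero    2≤M M≤ r ¬r = ¬r r
  contract* {M} {a} p (suc d) 2≤M M≤ r ¬r =
    contract (d + p) 2≤M (≤-trans M≤ (^-monoʳ-≤ 2 (s≤s (m≤n+m p d))))
      (subst (λ n → Realizable (suc n) M a) (+-suc d p) r)
      λ r′ → contract* p d 2≤M M≤ (subst (λ n → Realizable n M a) (sym (+-suc d p)) r′) ¬r

  -- Descent on the exponent takes the place of a first j. If (q+1)ʲ⁺¹ ≥ 2qʲ⁺¹, the shrunken power
  -- contracts to a full power set, so some degree is at least qʲ⁺¹ = 2ᵖ · 2qʲ. It is at most
  -- 2ᵖ(q+1)ʲ, hence (q+1)ʲ ≥ 2qʲ. At exponent 0 this reads 2 ≤ 1.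
  powers-bounded : ∀ p → let q = 2 ^ suc p in Realizable (suc (suc p)) (suc q) (2 ^ p) →
                   ∀ j → ¬ (2 * q ^ j ≤ suc q ^ j)
  powers-bounded p r zero    (s≤s ())
  powers-bounded p r (suc j) 2q^≤ =
    -- The power lives on (j+1)(n₀+1) elements, which is j more than the n₀(j+1) + 1 that a power
    -- set of 2qʲ⁺¹ sets requires.
    contract* (n₀ * suc j) j (^-monoʳ-≤ 2 {1} {suc (n₀ * suc j)} (s≤s z≤n)) ≤-refl r₂ λ r₃ →
      powers-bounded p r j (*-cancelˡ-≤ (2 ^ p) ⦃ m^n≢0 2 p ⦄ (begin
        2 ^ p * (2 * q ^ j) ≡⟨ lemma (2 ^ p) (q ^ j) ⟩
        q * q ^ j           ≡⟨ ^-*-assoc 2 n₀ (suc j) ⟩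
        2 ^ (n₀ * suc j)    ≤⟨ full⇒2^p≤a (n₀ * suc j) r₃ ⟩
        2 ^ p * suc q ^ j   ∎))
    where
    open ≤-Reasoning
    n₀ = suc p
    q = 2 ^ n₀
    lemma : ∀ x y → x * (2 * y) ≡ (2 * x) * y
    lemma = solve-∀
    ground : ∀ j n → suc j * suc n ≡ j + suc (n * suc j)
    ground = solve-∀
    r₁ : Realizable (suc j * suc n₀) (2 * 2 ^ (n₀ * suc j)) (2 ^ p * suc q ^ j)
    r₁ = shrink (≤-trans (≤-reflexive (cong (2 *_) (sym (^-*-assoc 2 n₀ (suc j))))) 2q^≤) (power r j)
    r₂ : Realizable (j + suc (n₀ * suc j)) (2 * 2 ^ (n₀ * suc j)) (2 ^ p * suc q ^ j)
    r₂ = subst (λ N → Realizable N (2 * 2 ^ (n₀ * suc j)) (2 ^ p * suc q ^ j)) (ground j n₀) r₁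

  -- By Bernoulli the exponent j = q already gives (q+1)ʲ ≥ 2qʲ, so a family with more than q sets
  -- is contradictory.
  dense-bound : ∀ p → a ≤ 2 ^ p → Realizable (suc (suc p)) M a → M ≤ 2 ^ suc p
  dense-bound p a≤ r = ≮⇒≥ λ q<M →
    powers-bounded p (shrink q<M (weaken a≤ r)) q (2*q^q≤[1+q]^q q (m^n>0 2 (suc p)))
    where q = 2 ^ suc p

  GStable⇒FStable : FStable
  GStable⇒FStable n@(suc p) a 1≤n 1≤a n≥ k k′ f f′ =
    ≤-antisym (IsF⇒upper f′ (extend (IsF⇒realizable f)))
              (decidable-stable (k′ ≤? k) λ k′≰k →
                contract p
                  -- The family {∅} shows 1 ≤ k, and k < k′, hence 2 ≤ k′ as stability of g
                  -- requires.
                  (≤-trans (s≤s (IsF⇒upper f (weaken z≤n (realizable-n-1-0 n)))) (≰⇒> k′≰k))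
                  (dense-bound p a≤2^p r′) r′ (k′≰k ∘ IsF⇒upper f))
    where
    r′ = IsF⇒realizable f′
    a≤2^p : a ≤ 2 ^ p
    a≤2^p = ⌈log₂n⌉≤k⇒n≤2^k a (s≤s⁻¹ (≤-trans (≤-reflexive (+-comm 1 _)) n≥))

theorem2p4 : (∀ (n a : ℕ) → 1 ≤ n → 1 ≤ a → n ≥ ⌈log₂ a ⌉ + 1 →
    ∀ k k' → IsF n a k → IsF (suc n) a k' → k ≡ k')
    ⇔
    (∀ (n' mm : ℕ) → 1 ≤ n' → 2 ≤ mm → mm ≤ 2 ^ n' → n' ≥ ⌈log₂ mm ⌉ →
    ∀ k k' → IsG n' mm k → IsG (suc n') mm k' → k ≡ k')
theorem2p4 = mk⇔ FStable⇒GStable GStable⇒FStable
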